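{- There is an absolute constant $C$ such that for every $n\ge 1$ and every $m$: if $\Gamma: M_n(GF(2))\to GF(2)^m$ is a linear code of matrices, then $m\ge 3n^2 - Cn^{5/3}$.
   Context: $M_n(GF(2))$ denotes the $n\times n$ matrices over $GF(2)$. For $v\in GF(2)^m$, $\mathrm{weight}(v)$ is the number of nonzero coordinates of $v$. A linear code of matrices is a map $\Gamma:M_n(GF(2))\to GF(2)^m$ that is $GF(2)$-linear and satisfies $\mathrm{weight}(\Gamma(a))\ge n\cdot \mathrm{rank}(a)$ for every $a\in M_n(GF(2))$. -}

module Defs where

open import Data.Bool using (Bool; true; false; _xor_; if_then_else_)
open import Data.Nat using (ℕ; zero; suc; _+_; _*_)
open import Data.Vec using (Vec; []; _∷_; zipWith; head; tail; count; toList)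
open import Data.List using (List; []; _∷_)
import Data.List as L
open import Data.Bool.Properties using (T?)
open import Data.Nat using (_≤_)
open import Relation.Binary.PropositionalEquality using (_≡_)

-- GF(2) is represented by Bool: addition is _xor_, multiplication is _∧_.

GF2^ : ℕ → Set
GF2^ m = Vec Bool m

_⊕_ : ∀ {m} → GF2^ m → GF2^ m → GF2^ m
_⊕_ = zipWith _xor_

weight : ∀ {m} → GF2^ m → ℕ
weight = count T?

Mat : ℕ → Set
Mat n = Vec (GF2^ n) n

_⊞_ : ∀ {n} → Mat n → Mat n → Mat n
_⊞_ = zipWith _⊕_

data Pivot (c : ℕ) : Set where
  none : Pivot c
  some : GF2^ (suc c) → List (GF2^ (suc c)) → Pivot c

findPivot : ∀ {c} → List (GF2^ (suc c)) → Pivot c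
findPivot [] = none
findPivot (r ∷ rs) with head r | findPivot rs
... | true  | _ = some r rs
... | false | none = none
... | false | some p rs' = some p (r ∷ rs')

rankRows : ∀ c → List (GF2^ c) → ℕ
rankRows zero    rs = 0
rankRows (suc c) rs with findPivot rs
... | none      = rankRows c (L.map tail rs)
... | some p qs = suc (rankRows c (L.map (λ r → tail (if head r then r ⊕ p else r)) qs))

rank : ∀ {n} → Mat n → ℕ
rank {n} a = rankRows n (toList a)

-- A linear code of matrices: a GF(2)-linear map Γ : M_n(GF(2)) → GF(2)^m
-- (over GF(2), linearity = additivity) with weight(Γ a) ≥ n · rank(a).
record IsLinearCodeOfMatrices (n m : ℕ) (Γ : Mat n → GF2^ m) : Set where
  field
    additive   : ∀ a b → Γ (a ⊞ b) ≡ Γ a ⊕ Γ b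
    rankBound  : ∀ a → n * rank a ≤ weight (Γ a)

{-# OPTIONS --safe #-}

-- Since Γ is injective, n² of its coordinates form an information set, so M_n(GF(2)) has a basis in
-- which a matrix with D nonzero coefficients has a codeword of weight at most D on that set.
-- The nonzero elements of the k-dimensional space of upper triangular Toeplitz matrices with band
-- width k have rank at least n - k, each witnessed by a nonzero minor of size n - k.  The product of
-- these 2^k - 1 minors, as a function of a k-tuple of matrices, is a polynomial of degree at most
-- 2^k n that is not identically zero; a nonzero polynomial function over GF(2) is nonzero at some
-- point of weight at most its degree.  So there are k matrices with at most 2^k n nonzero
-- coefficients in all, every nonzero combination of which has rank at least n - k.  Each of the
-- m - n² remaining coordinates is nonzero on at most half of the 2^k combinations, so summing the
-- weights gives (2^k - 1) n (n - k) ≤ 4^k n + 2^(k-1) (m - n²), and 2^k ≈ n^(1/3) is good enough.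

module Submission where

open import Defs
open import Algebra.Bundles using (CommutativeRing)
open import Data.Bool using (Bool; true; false; not; _∧_; _xor_; if_then_else_)
open import Data.Bool.Properties using (xor-comm; xor-assoc; xor-same; xor-identityˡ; xor-identityʳ; ∧-distribˡ-xor; ∧-distribʳ-xor; ∧-zeroʳ; xor-∧-commutativeRing)
open import Data.Empty using (⊥; ⊥-elim)
open import Data.Fin using (Fin; zero; suc; toℕ)
open import Data.List using (List; []; _∷_; _++_; length; applyUpTo)
import Data.List as List
open import Data.List.Properties using (map-∘; length-map; length-applyUpTo; map-applyUpTo)
open import Data.List.Relation.Binary.Permutation.Propositional using (_↭_; prep; swap; ↭-sym)
import Data.List.Relation.Binary.Permutation.Propositional as Perm
open import Data.List.Relation.Binary.Permutation.Propositional.Properties using (shift; ↭-length; All-resp-↭)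
import Data.List.Relation.Binary.Permutation.Propositional.Properties as Permₚ
open import Data.List.Relation.Unary.All using (All; []; _∷_)
import Data.List.Relation.Unary.All as All
import Data.List.Relation.Unary.All.Properties as Allₚ
open import Data.Maybe using (Maybe; just; nothing; maybe)
import Data.Maybe as Maybe
open import Data.Nat using (ℕ; zero; suc; _+_; _*_; _∸_; _^_; _≤_; _<_; z≤n; s≤s; _<?_)
open import Data.Nat.Properties
open import Data.Nat.Tactic.RingSolver using (solve-∀)
open import Data.Product using (∃; _×_; _,_; proj₁; proj₂)
open import Data.Sum using (_⊎_; inj₁; inj₂)
open import Data.Unit using (⊤; tt)
open import Data.Vec using (Vec; []; _∷_; head; tail; replicate; zipWith; lookup; removeAt; take; drop; concat; tabulate; toList)
import Data.Vec as Vec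
open import Data.Vec.Properties using (zipWith-comm; zipWith-assoc; zipWith-identityˡ; zipWith-identityʳ; lookup-zipWith; take-zipWith; drop-zipWith; take++drop≡id; zipWith-++)
open import Function using (_∘_; id)
open import Relation.Binary.PropositionalEquality using (_≡_; refl; sym; trans; cong; cong₂; subst; module ≡-Reasoning)
open import Relation.Nullary using (yes; no)

open import Algebra.Properties.CommutativeSemigroup (CommutativeRing.+-commutativeSemigroup xor-∧-commutativeRing)
  using () renaming (interchange to xor-interchange)
open import Algebra.Properties.CommutativeSemigroup +-commutativeSemigroup
  using () renaming (interchange to +-interchange; x∙yz≈y∙xz to +-leftSwap)

private
  variable
    a b c k m n : ℕ

-- Vectors over GF(2)

𝟘 : GF2^ m
𝟘 = replicate _ false

⊕-comm : (u v : GF2^ m) → u ⊕ v ≡ v ⊕ u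
⊕-comm = zipWith-comm xor-comm

⊕-assoc : (u v w : GF2^ m) → (u ⊕ v) ⊕ w ≡ u ⊕ (v ⊕ w)
⊕-assoc = zipWith-assoc xor-assoc

⊕-identityˡ : (v : GF2^ m) → 𝟘 ⊕ v ≡ v
⊕-identityˡ = zipWith-identityˡ xor-identityˡ

⊕-identityʳ : (v : GF2^ m) → v ⊕ 𝟘 ≡ v
⊕-identityʳ = zipWith-identityʳ xor-identityʳ

⊕-self : (v : GF2^ m) → v ⊕ v ≡ 𝟘
⊕-self []      = refl
⊕-self (x ∷ v) = cong₂ _∷_ (xor-same x) (⊕-self v)

⊕-cancelˡ : (u v : GF2^ m) → u ⊕ (u ⊕ v) ≡ v
⊕-cancelˡ u v = trans (sym (⊕-assoc u u v)) (trans (cong (_⊕ v) (⊕-self u)) (⊕-identityˡ v))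

⊕-cancelʳ : (u v : GF2^ m) → (u ⊕ v) ⊕ v ≡ u
⊕-cancelʳ u v = trans (⊕-assoc u v v) (trans (cong (u ⊕_) (⊕-self v)) (⊕-identityʳ u))

⊕-interchange : (u v w x : GF2^ m) → (u ⊕ v) ⊕ (w ⊕ x) ≡ (u ⊕ w) ⊕ (v ⊕ x)
⊕-interchange []      []      []      []      = refl
⊕-interchange (a ∷ u) (b ∷ v) (c ∷ w) (d ∷ x) =
  cong₂ _∷_ (xor-interchange a b c d) (⊕-interchange u v w x)

head-⊕ : (u v : GF2^ (suc m)) → head (u ⊕ v) ≡ head u xor head v
head-⊕ (_ ∷ _) (_ ∷ _) = refl

tail-⊕ : (u v : GF2^ (suc m)) → tail (u ⊕ v) ≡ tail u ⊕ tail v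
tail-⊕ (_ ∷ _) (_ ∷ _) = refl

bit : Bool → ℕ
bit true  = 1
bit false = 0

weight-∷ : (x : Bool) (v : GF2^ m) → weight (x ∷ v) ≡ bit x + weight v
weight-∷ true  v = refl
weight-∷ false v = refl

weight-𝟘 : ∀ m → weight (𝟘 {m}) ≡ 0
weight-𝟘 zero    = refl
weight-𝟘 (suc m) = weight-𝟘 m

weight-⊕ : (u v : GF2^ m) → weight (u ⊕ v) ≤ weight u + weight v
weight-⊕ []          []          = z≤n
weight-⊕ (false ∷ u) (false ∷ v) = weight-⊕ u v
weight-⊕ (false ∷ u) (true ∷ v)  = ≤-trans (s≤s (weight-⊕ u v)) (≤-reflexive (sym (+-suc _ _)))
weight-⊕ (true ∷ u)  (false ∷ v) = s≤s (weight-⊕ u v)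
weight-⊕ (true ∷ u)  (true ∷ v)  = ≤-trans (weight-⊕ u v) (+-mono-≤ (n≤1+n _) (n≤1+n _))

weight-++ : (u : GF2^ a) (v : GF2^ b) → weight (u Vec.++ v) ≡ weight u + weight v
weight-++ []          v = refl
weight-++ (true ∷ u)  v = cong suc (weight-++ u v)
weight-++ (false ∷ u) v = weight-++ u v

Additive : (GF2^ a → GF2^ b) → Set
Additive f = ∀ x y → f (x ⊕ y) ≡ f x ⊕ f y

IsFunctional : (GF2^ a → Bool) → Set
IsFunctional f = ∀ x y → f (x ⊕ y) ≡ f x xor f y

additive-∘ : {f : GF2^ b → GF2^ c} {g : GF2^ a → GF2^ b} → Additive f → Additive g → Additive (f ∘ g)
additive-∘ {f = f} f+ g+ x y = trans (cong f (g+ x y)) (f+ _ _)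

additive-⊕ : {f g : GF2^ a → GF2^ b} → Additive f → Additive g → Additive (λ x → f x ⊕ g x)
additive-⊕ f+ g+ x y = trans (cong₂ _⊕_ (f+ x y) (g+ x y)) (⊕-interchange _ _ _ _)

additive-𝟘 : {f : GF2^ a → GF2^ b} → Additive f → f 𝟘 ≡ 𝟘
additive-𝟘 {f = f} f+ = trans (cong f (sym (⊕-self 𝟘))) (trans (f+ 𝟘 𝟘) (⊕-self (f 𝟘)))

-- Linear combinations and block decompositions

scale : Bool → GF2^ m → GF2^ m
scale b v = if b then v else 𝟘

scale-xor : ∀ b c (v : GF2^ m) → scale (b xor c) v ≡ scale b v ⊕ scale c v
scale-xor false c     v = sym (⊕-identityˡ _)
scale-xor true  false v = sym (⊕-identityʳ v)
scale-xor true  true  v = sym (⊕-self v)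

scale-⊕ : ∀ b (u v : GF2^ m) → scale b (u ⊕ v) ≡ scale b u ⊕ scale b v
scale-⊕ false u v = sym (⊕-self 𝟘)
scale-⊕ true  u v = refl

comb : Vec Bool k → Vec (GF2^ m) k → GF2^ m
comb []      []       = 𝟘
comb (c ∷ cs) (v ∷ vs) = scale c v ⊕ comb cs vs

comb-⊕ : (cs : Vec Bool k) (us vs : Vec (GF2^ m) k) → comb cs (zipWith _⊕_ us vs) ≡ comb cs us ⊕ comb cs vs
comb-⊕ []       []       []       = sym (⊕-self 𝟘)
comb-⊕ (c ∷ cs) (u ∷ us) (v ∷ vs) =
  trans (cong₂ _⊕_ (scale-⊕ c u v) (comb-⊕ cs us vs)) (⊕-interchange _ _ _ _)

additive-comb : {f : GF2^ a → GF2^ b} → Additive f → (cs : Vec Bool k) (vs : Vec (GF2^ a) k) →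
                f (comb cs vs) ≡ comb cs (Vec.map f vs)
additive-comb f+ []           []       = additive-𝟘 f+
additive-comb f+ (false ∷ cs) (v ∷ vs) =
  trans (f+ _ _) (cong₂ _⊕_ (additive-𝟘 f+) (additive-comb f+ cs vs))
additive-comb f+ (true ∷ cs)  (v ∷ vs) = trans (f+ _ _) (cong (_ ⊕_) (additive-comb f+ cs vs))

-- The `vs` are the images of the unit vectors. This turns a space parametrised by coefficients,
-- such as the Toeplitz matrices, into the combinations of `k` fixed vectors.
additive-as-comb : (χ : GF2^ k → GF2^ m) → Additive χ → ∃ λ vs → ∀ cs → comb cs vs ≡ χ cs
additive-as-comb {zero}  χ χ+ = [] , λ { [] → sym (additive-𝟘 χ+) }
additive-as-comb {suc k} χ χ+ with additive-as-comb (χ ∘ (false ∷_)) (λ x y → χ+ _ _)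
... | vs , eq = χ (true ∷ 𝟘) ∷ vs , λ
  { (false ∷ cs) → trans (⊕-identityˡ _) (eq cs)
  ; (true ∷ cs)  → trans (cong (_ ⊕_) (eq cs)) (trans (sym (χ+ _ _)) (cong (χ ∘ (true ∷_)) (⊕-identityˡ cs))) }

total-weight : Vec (GF2^ m) k → ℕ
total-weight []       = 0
total-weight (v ∷ vs) = weight v + total-weight vs

weight-comb : (cs : Vec Bool k) (vs : Vec (GF2^ m) k) → weight (comb cs vs) ≤ total-weight vs
weight-comb {m = m} [] []         = ≤-reflexive (weight-𝟘 m)
weight-comb (false ∷ cs) (v ∷ vs) =
  ≤-trans (≤-reflexive (cong weight (⊕-identityˡ (comb cs vs)))) (≤-trans (weight-comb cs vs) (m≤n+m _ _))
weight-comb (true ∷ cs)  (v ∷ vs) =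
  ≤-trans (weight-⊕ v _) (+-monoʳ-≤ (weight v) (weight-comb cs vs))

-- Used both to cut a vector into the rows of a matrix and to read one long vector as a `k`-tuple of
-- matrices.
blocks : ∀ r {c} → GF2^ (r * c) → Vec (GF2^ c) r
blocks zero    v = []
blocks (suc r) {c} v = take c v ∷ blocks r (drop c v)

blocks-⊕ : ∀ r (u v : GF2^ (r * c)) → blocks r (u ⊕ v) ≡ zipWith _⊕_ (blocks r u) (blocks r v)
blocks-⊕ zero u v = refl
blocks-⊕ {c} (suc r) u v = cong₂ _∷_ (take-zipWith _xor_ u v)
  (trans (cong (blocks r) (drop-zipWith _xor_ u v)) (blocks-⊕ r (drop c u) (drop c v)))

blocks-concat : (vs : Vec (GF2^ c) n) → blocks n (concat vs) ≡ vs
blocks-concat []       = refl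
blocks-concat {c} (v ∷ vs) = cong₂ _∷_ (take-++ v (concat vs)) (trans (cong (blocks _) (drop-++ v (concat vs))) (blocks-concat vs))
  where
  take-++ : ∀ {a b} (u : GF2^ a) (v : GF2^ b) → take a (u Vec.++ v) ≡ u
  take-++ []      v = refl
  take-++ (x ∷ u) v = cong (x ∷_) (take-++ u v)
  drop-++ : ∀ {a b} (u : GF2^ a) (v : GF2^ b) → drop a (u Vec.++ v) ≡ v
  drop-++ []      v = refl
  drop-++ (x ∷ u) v = drop-++ u v

concat-⊕ : (us vs : Vec (GF2^ c) n) → concat (zipWith _⊕_ us vs) ≡ concat us ⊕ concat vs
concat-⊕ []       []       = refl
concat-⊕ (u ∷ us) (v ∷ vs) =
  trans (cong (_ Vec.++_) (concat-⊕ us vs)) (sym (zipWith-++ _xor_ u (concat us) v (concat vs)))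

total-weight-blocks : ∀ r (v : GF2^ (r * c)) → total-weight (blocks r v) ≡ weight v
total-weight-blocks zero    [] = refl
total-weight-blocks {c} (suc r) v = begin
  weight (take c v) + total-weight (blocks r (drop c v)) ≡⟨ cong (weight (take c v) +_) (total-weight-blocks r (drop c v)) ⟩
  weight (take c v) + weight (drop c v)                  ≡⟨ weight-++ (take c v) (drop c v) ⟨
  weight (take c v Vec.++ drop c v)                      ≡⟨ cong weight (take++drop≡id c v) ⟩
  weight v                                               ∎
  where open ≡-Reasoning

blocks-𝟘 : ∀ r (v : GF2^ (r * c)) → All (_≡ 𝟘) (toList (blocks r v)) → v ≡ 𝟘
blocks-𝟘 zero    [] _ = refl
blocks-𝟘 {c} (suc r) v (p ∷ ps) =
  trans (sym (take++drop≡id c v)) (trans (cong₂ Vec._++_ p (blocks-𝟘 r (drop c v) ps)) (𝟘-++ c))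
  where
  𝟘-++ : ∀ a {b} → 𝟘 {a} Vec.++ 𝟘 {b} ≡ 𝟘
  𝟘-++ zero    = refl
  𝟘-++ (suc a) = cong (false ∷_) (𝟘-++ a)

-- Polynomial functions over GF(2)

∂ : (GF2^ (suc m) → Bool) → GF2^ m → Bool
∂ f x = f (false ∷ x) xor f (true ∷ x)

-- DegBelow m d f says that f has degree < d, by recursion on f = f|₀ + x₀ ∂f; DegBelow m 0 is the zero function.
DegBelow : ∀ m → ℕ → (GF2^ m → Bool) → Set
DegBelow m       zero    f = ∀ x → f x ≡ false
DegBelow zero    (suc d) f = ⊤
DegBelow (suc m) (suc d) f = DegBelow m (suc d) (f ∘ (false ∷_)) × DegBelow m d (∂ f)

deg-cong : ∀ m d {f g : GF2^ m → Bool} → (∀ x → f x ≡ g x) → DegBelow m d f → DegBelow m d g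
deg-cong m       zero    f≗g p = λ x → trans (sym (f≗g x)) (p x)
deg-cong zero    (suc d) f≗g p = tt
deg-cong (suc m) (suc d) f≗g (p , q) =
  deg-cong m (suc d) (λ x → f≗g _) p , deg-cong m d (λ x → cong₂ _xor_ (f≗g _) (f≗g _)) q

deg-zero : ∀ m d {f : GF2^ m → Bool} → (∀ x → f x ≡ false) → DegBelow m d f
deg-zero m       zero    f≗0 = f≗0
deg-zero zero    (suc d) f≗0 = tt
deg-zero (suc m) (suc d) f≗0 =
  deg-zero m (suc d) (λ x → f≗0 _) , deg-zero m d (λ x → cong₂ _xor_ (f≗0 _) (f≗0 _))

deg-suc : ∀ m d {f : GF2^ m → Bool} → DegBelow m d f → DegBelow m (suc d) f
deg-suc m       zero    p       = deg-zero m 1 p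
deg-suc zero    (suc d) p       = tt
deg-suc (suc m) (suc d) (p , q) = deg-suc m (suc d) p , deg-suc m d q

deg-const : ∀ m d (b : Bool) → DegBelow m (suc d) (λ _ → b)
deg-const zero    d b = tt
deg-const (suc m) d b = deg-const m d b , deg-zero m d (λ _ → xor-same b)

deg-xor : ∀ m d {f g : GF2^ m → Bool} → DegBelow m d f → DegBelow m d g → DegBelow m d (λ x → f x xor g x)
deg-xor m       zero    p q = λ x → cong₂ _xor_ (p x) (q x)
deg-xor zero    (suc d) p q = tt
deg-xor (suc m) (suc d) {f} {g} (p , p′) (q , q′) = deg-xor m (suc d) p q ,
  deg-cong m d (λ x → xor-interchange (f (false ∷ x)) (f (true ∷ x)) (g (false ∷ x)) (g (true ∷ x))) (deg-xor m d p′ q′)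

-- Product rule: with `x`, `y` the values of f and `z`, `w` those of g at first coordinate 0 and 1,
-- it reads f₀ ∂g + ∂f g₀ + ∂f ∂g = ∂(f g).
∧-difference : ∀ x y z w → ((x ∧ (z xor w)) xor ((x xor y) ∧ z)) xor ((x xor y) ∧ (z xor w)) ≡ (x ∧ z) xor (y ∧ w)
∧-difference false false z     w     = refl
∧-difference false true  false w     = refl
∧-difference false true  true  false = refl
∧-difference false true  true  true  = refl
∧-difference true  false false false = refl
∧-difference true  false false true  = refl
∧-difference true  false true  false = refl
∧-difference true  false true  true  = refl
∧-difference true  true  false false = refl
∧-difference true  true  false true  = refl
∧-difference true  true  true  false = refl
∧-difference true  true  true  true  = refl

mutual
  -- Induction on the number of variables: each of the three terms of the product rule has a
  -- derivative as a factor, hence a smaller degree bound. The variants `deg-∧ˡ` and `deg-∧ʳ` also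
  -- admit the bound 0, where one factor is the zero function.
  deg-∧ : ∀ m d e {f g : GF2^ m → Bool} → DegBelow m (suc d) f → DegBelow m (suc e) g →
          DegBelow m (suc (d + e)) (λ x → f x ∧ g x)
  deg-∧ zero    d e p q = tt
  deg-∧ (suc m) d e {f} {g} (p , p′) (q , q′) = deg-∧ m d e p q ,
    deg-cong m (d + e)
      (λ x → ∧-difference (f (false ∷ x)) (f (true ∷ x)) (g (false ∷ x)) (g (true ∷ x)))
      (deg-xor m (d + e)
        (deg-xor m (d + e) (deg-∧ˡ m d e p q′) (deg-∧ʳ m d e p′ q))
        (deg-∧ˡ m d e (deg-suc m d p′) q′))

  deg-∧ˡ : ∀ m d e {f g : GF2^ m → Bool} → DegBelow m (suc d) f → DegBelow m e g →
           DegBelow m (d + e) (λ x → f x ∧ g x)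
  deg-∧ˡ m d zero    {f} p q = deg-zero m (d + 0) (λ x → trans (cong (f x ∧_) (q x)) (∧-zeroʳ (f x)))
  deg-∧ˡ m d (suc e) {f} {g} p q =
    subst (λ l → DegBelow m l (λ x → f x ∧ g x)) (sym (+-suc d e)) (deg-∧ m d e p q)

  deg-∧ʳ : ∀ m d e {f g : GF2^ m → Bool} → DegBelow m d f → DegBelow m (suc e) g →
           DegBelow m (d + e) (λ x → f x ∧ g x)
  deg-∧ʳ m zero    e {g = g} p q = deg-zero m e (λ x → cong (_∧ g x) (p x))
  deg-∧ʳ m (suc d) e p q = deg-∧ m d e p q

-- The derivative is constant, because `false ∷ x` and `true ∷ x` always add up to the first unit
-- vector.
deg-functional : ∀ m {f : GF2^ m → Bool} → IsFunctional f → DegBelow m 2 f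
deg-functional zero    f+ = tt
deg-functional (suc m) {f} f+ = deg-functional m (λ x y → f+ _ _) ,
  deg-cong m 1 (λ x → trans (cong (f ∘ (true ∷_)) (sym (⊕-self x))) (f+ (false ∷ x) (true ∷ x)))
    (deg-const m 0 (f (true ∷ 𝟘)))

xor-split : ∀ x y → x ≡ true → (y ≡ true) ⊎ (y xor x ≡ true)
xor-split true true  refl = inj₁ refl
xor-split true false refl = inj₂ refl

-- If f (true ∷ x) ≠ 0 then f (false ∷_) or ∂ f is nonzero at x, and ∂ f has smaller degree.
sparse-witness : ∀ m d {f : GF2^ m → Bool} → DegBelow m d f → ∀ x → f x ≡ true →
                 ∃ λ y → weight y < d × f y ≡ true
sparse-witness m       zero    p x fx with trans (sym fx) (p x)
... | ()
sparse-witness zero    (suc d) p [] fx = [] , s≤s z≤n , fx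
sparse-witness (suc m) (suc d) (p , q) (false ∷ x) fx with sparse-witness m (suc d) p x fx
... | y , w , fy = false ∷ y , w , fy
sparse-witness (suc m) (suc d) {f} (p , q) (true ∷ x) fx with xor-split _ (f (false ∷ x)) fx
... | inj₁ fx₀ with sparse-witness m (suc d) p x fx₀
...   | y , w , fy = false ∷ y , w , fy
sparse-witness (suc m) (suc d) {f} (p , q) (true ∷ x) fx | inj₂ ∂fx with sparse-witness m d q x ∂fx
...   | y , w , ∂fy with f (false ∷ y) in eq
...     | true  = false ∷ y , m≤n⇒m≤1+n w , eq
...     | false = true ∷ y , s≤s w , ∂fy

-- Alternating forms and rank

-- Forms take lists, so the number of arguments can vary. In characteristic 2 a swap costs no sign;
-- given `permute`, the other two laws are stated for leading arguments only.
record Alternating (F : List (GF2^ c) → Bool) : Set where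
  field
    permute   : ∀ {us vs} → us ↭ vs → F us ≡ F vs
    additive  : ∀ u v ws → F ((u ⊕ v) ∷ ws) ≡ F (u ∷ ws) xor F (v ∷ ws)
    alternate : ∀ u ws → F (u ∷ u ∷ ws) ≡ false

alternating-fix : {F : List (GF2^ c) → Bool} → Alternating F → ∀ p → Alternating (F ∘ (p ∷_))
alternating-fix {F = F} alt p = record
  { permute   = λ σ → permute (prep p σ)
  ; additive  = λ u v ws → trans (permute (swap p _ Perm.refl))
      (trans (additive u v (p ∷ ws)) (cong₂ _xor_ (permute (swap u p Perm.refl)) (permute (swap v p Perm.refl))))
  ; alternate = λ u ws →
      trans (permute (Perm.trans (swap p u Perm.refl) (prep u (swap p u Perm.refl)))) (alternate u (p ∷ ws))
  }
  where open Alternating alt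

alternating-map : {F : List (GF2^ b) → Bool} {f : GF2^ a → GF2^ b} → Alternating F → Additive f →
                  Alternating (F ∘ List.map f)
alternating-map {F = F} {f} alt f+ = record
  { permute   = λ σ → permute (Permₚ.map⁺ f σ)
  ; additive  = λ u v ws → trans (cong (λ x → F (x ∷ List.map f ws)) (f+ u v)) (additive (f u) (f v) _)
  ; alternate = λ u ws → alternate (f u) _
  }
  where open Alternating alt

InSpan : List (GF2^ c) → GF2^ c → Set
InSpan []      v = v ≡ 𝟘
InSpan (b ∷ B) v = InSpan B v ⊎ InSpan B (b ⊕ v)

inSpan-𝟘 : (B : List (GF2^ c)) → InSpan B 𝟘
inSpan-𝟘 []      = refl
inSpan-𝟘 (b ∷ B) = inj₁ (inSpan-𝟘 B)

inSpan-false∷ : (B : List (GF2^ c)) {v : GF2^ c} → InSpan B v → InSpan (List.map (false ∷_) B) (false ∷ v)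
inSpan-false∷ []      refl     = refl
inSpan-false∷ (b ∷ B) (inj₁ p) = inj₁ (inSpan-false∷ B p)
inSpan-false∷ (b ∷ B) (inj₂ p) = inj₂ (inSpan-false∷ B p)

module _ (b : GF2^ c) (B : List (GF2^ c)) {F : List (GF2^ c) → Bool} (alt : Alternating F) {l : ℕ}
         (vanish-B  : ∀ vs → All (InSpan B) vs → length vs ≡ suc l → F vs ≡ false)
         (vanish-b∷ : ∀ vs → All (InSpan (b ∷ B)) vs → length vs ≡ l → F (b ∷ vs) ≡ false) where
  open Alternating alt

  -- Arguments move one by one from `vs` to `us`. One that involves `b` is split as b + (b + v): the
  -- first summand puts `b` in front, where `vanish-b∷` applies, and the second lies in the span of
  -- `B`.
  vanish-b∷B : ∀ us vs → All (InSpan B) us → All (InSpan (b ∷ B)) vs → length (us ++ vs) ≡ suc l →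
               F (us ++ vs) ≡ false
  vanish-b∷B us []       p []             eq = vanish-B (us ++ []) (Allₚ.++⁺ p []) eq
  vanish-b∷B us (v ∷ vs) p (inj₁ q ∷ qs) eq = trans (permute σ)
    (vanish-b∷B (v ∷ us) vs (q ∷ p) qs (trans (sym (↭-length σ)) eq))
    where
    σ : us ++ v ∷ vs ↭ v ∷ us ++ vs
    σ = shift v us vs
  vanish-b∷B us (v ∷ vs) p (inj₂ q ∷ qs) eq = begin
    F (us ++ v ∷ vs)                                ≡⟨ permute σ ⟩
    F (v ∷ us ++ vs)                                ≡⟨ cong (λ x → F (x ∷ us ++ vs)) (⊕-cancelˡ b v) ⟨
    F ((b ⊕ (b ⊕ v)) ∷ us ++ vs)                    ≡⟨ additive b (b ⊕ v) (us ++ vs) ⟩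
    F (b ∷ us ++ vs) xor F ((b ⊕ v) ∷ us ++ vs)     ≡⟨ cong₂ _xor_
      (vanish-b∷ (us ++ vs) (Allₚ.++⁺ (All.map inj₁ p) qs) (suc-injective eq′))
      (vanish-b∷B ((b ⊕ v) ∷ us) vs (q ∷ p) qs eq′) ⟩
    false                                           ∎
    where
    open ≡-Reasoning
    σ : us ++ v ∷ vs ↭ v ∷ us ++ vs
    σ = shift v us vs
    eq′ : suc (length (us ++ vs)) ≡ suc l
    eq′ = trans (sym (↭-length σ)) eq

-- Induction on the generators. With `b` fixed in front, the form is again alternating with one
-- argument less; splitting along `b` once more leaves either two copies of `b` or only arguments
-- from the span of `B`.
alternating-vanishes : (B : List (GF2^ c)) {F : List (GF2^ c) → Bool} → Alternating F → ∀ {l} vs →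
                       All (InSpan B) vs → length vs ≡ l → length B < l → F vs ≡ false
alternating-vanishes [] {F} alt (v ∷ vs) (refl ∷ _) refl _ =
  trans (cong (λ x → F (x ∷ vs)) (sym (⊕-self 𝟘))) (trans (Alternating.additive alt 𝟘 𝟘 vs) (xor-same (F (𝟘 ∷ vs))))
alternating-vanishes (b ∷ B) {F} alt {suc (suc l)} vs p eq (s≤s B<) =
  vanish-b∷B b B alt
    (λ ws q e → alternating-vanishes B alt ws q e (m≤n⇒m≤1+n B<))
    (λ ws q e → vanish-b∷B b B (alternating-fix alt b)
      (λ xs r e′ → alternating-vanishes B (alternating-fix alt b) xs r e′ B<)
      (λ xs _ _ → Alternating.alternate alt b xs)
      [] ws [] q e)
    [] vs [] p eq

-- Row elimination and spanning sets

findPivot-none : (rs : List (GF2^ (suc c))) → findPivot rs ≡ none → All (λ r → head r ≡ false) rs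
findPivot-none []       _  = []
findPivot-none (r ∷ rs) eq with head r in hr | findPivot rs in eq′
findPivot-none (r ∷ rs) () | true  | _
findPivot-none (r ∷ rs) eq | false | none = hr ∷ findPivot-none rs eq′
findPivot-none (r ∷ rs) () | false | some _ _

findPivot-some : (rs : List (GF2^ (suc c))) {p : GF2^ (suc c)} {qs : List (GF2^ (suc c))} →
                 findPivot rs ≡ some p qs → head p ≡ true × rs ↭ p ∷ qs
findPivot-some (r ∷ rs) eq with head r in hr | findPivot rs in eq′
findPivot-some (r ∷ rs) refl | true  | _ = hr , Perm.refl
findPivot-some (r ∷ rs) ()   | false | none
findPivot-some (r ∷ rs) refl | false | some p qs with findPivot-some rs eq′
... | hp , σ = hp , Perm.trans (prep r σ) (swap r p Perm.refl)

cons-tail : (v : GF2^ (suc c)) {x : Bool} → head v ≡ x → v ≡ x ∷ tail v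
cons-tail (_ ∷ _) refl = refl

-- Follows the elimination in `rankRows`: the pivots, padded with zeros in the eliminated columns,
-- span all rows, since reduction changes a row at most by adding the pivot.
rows-spanned : ∀ c (rs : List (GF2^ c)) → ∃ λ B → length B ≡ rankRows c rs × All (InSpan B) rs
rows-spanned zero    rs = [] , refl , All.universal (λ { [] → refl }) rs
rows-spanned (suc c) rs with findPivot rs in eq
... | none with rows-spanned c (List.map tail rs)
...   | B , len , spn = List.map (false ∷_) B , trans (length-map (false ∷_) B) len ,
        All.zipWith (λ { {r} (hr , s) → subst (InSpan _) (sym (cons-tail r hr)) (inSpan-false∷ B s) })
          (findPivot-none rs eq , Allₚ.map⁻ spn)
rows-spanned (suc c) rs | some p qs
  with rows-spanned c (List.map (λ r → tail (if head r then r ⊕ p else r)) qs) | findPivot-some rs eq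
...   | B , len , spn | hp , σ = p ∷ List.map (false ∷_) B , cong suc (trans (length-map (false ∷_) B) len) ,
        All-resp-↭ (↭-sym σ) (p∈ ∷ All.map (λ {q} → q∈ q) (Allₚ.map⁻ spn))
  where
  B₀ = List.map (false ∷_) B
  p∈ : InSpan (p ∷ B₀) p
  p∈ = inj₂ (subst (InSpan B₀) (sym (⊕-self p)) (inSpan-𝟘 B₀))
  q∈ : ∀ q → InSpan B (tail (if head q then q ⊕ p else q)) → InSpan (p ∷ B₀) q
  q∈ q s with head q in hq
  ... | true  = inj₂ (subst (InSpan B₀)
                  (trans (sym (cons-tail (q ⊕ p) (trans (head-⊕ q p) (cong₂ _xor_ hq hp)))) (⊕-comm q p))
                  (inSpan-false∷ B s))
  ... | false = inj₁ (subst (InSpan B₀) (sym (cons-tail q hq)) (inSpan-false∷ B s))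

-- Determinants over GF(2)

-- Sums over the ways to pick one entry, with the others kept in order; as used in `det`, this is
-- Laplace expansion along the first column.
expand : {A : Set} → (A → List A → Bool) → List A → Bool
expand G []       = false
expand G (x ∷ xs) = G x xs xor expand (λ y ys → G y (x ∷ ys)) xs

module _ {A : Set} where

  expand-cong : {G H : A → List A → Bool} → (∀ x xs → G x xs ≡ H x xs) → ∀ xs → expand G xs ≡ expand H xs
  expand-cong G≗H []       = refl
  expand-cong G≗H (x ∷ xs) = cong₂ _xor_ (G≗H x xs) (expand-cong (λ y ys → G≗H y (x ∷ ys)) xs)

  expand-xor : (G H : A → List A → Bool) → ∀ xs →
               expand (λ y ys → G y ys xor H y ys) xs ≡ expand G xs xor expand H xs
  expand-xor G H []       = refl
  expand-xor G H (x ∷ xs) = trans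
    (cong ((G x xs xor H x xs) xor_) (expand-xor (λ y ys → G y (x ∷ ys)) (λ y ys → H y (x ∷ ys)) xs))
    (xor-interchange (G x xs) (H x xs) (expand (λ y ys → G y (x ∷ ys)) xs) (expand (λ y ys → H y (x ∷ ys)) xs))

  expand-vanishes : {G : A → List A → Bool} → ∀ {xs} → All (λ x → ∀ ys → G x ys ≡ false) xs → expand G xs ≡ false
  expand-vanishes []       = refl
  expand-vanishes (p ∷ ps) = cong₂ _xor_ (p _) (expand-vanishes (All.map (λ q ys → q _) ps))

  -- In the `swap` case the two leading terms trade places, and every later term has both entries at
  -- the head of its remaining list, whose order `G` ignores.
  expand-↭ : {G : A → List A → Bool} → (∀ x {ys zs} → ys ↭ zs → G x ys ≡ G x zs) →
             ∀ {xs ys} → xs ↭ ys → expand G xs ≡ expand G ys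
  expand-↭ G↭ Perm.refl        = refl
  expand-↭ G↭ (prep x σ)       = cong₂ _xor_ (G↭ x σ) (expand-↭ (λ y τ → G↭ y (prep x τ)) σ)
  expand-↭ {G} G↭ (Perm.trans σ τ) = trans (expand-↭ {G} G↭ σ) (expand-↭ {G} G↭ τ)
  expand-↭ {G} G↭ (swap {xs} {ys} x y σ) = begin
    G x (y ∷ xs) xor (G y (x ∷ xs) xor E x y xs)  ≡⟨ xor-assoc (G x (y ∷ xs)) (G y (x ∷ xs)) (E x y xs) ⟨
    (G x (y ∷ xs) xor G y (x ∷ xs)) xor E x y xs  ≡⟨ cong₂ _xor_ (xor-comm (G x (y ∷ xs)) (G y (x ∷ xs)))
                                                     (expand-cong (λ z zs → G↭ z (swap x y Perm.refl)) xs) ⟩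
    (G y (x ∷ xs) xor G x (y ∷ xs)) xor E y x xs  ≡⟨ cong₂ _xor_ (cong₂ _xor_ (G↭ y (prep x σ)) (G↭ x (prep y σ)))
                                                     (expand-↭ (λ z τ → G↭ z (prep y (prep x τ))) σ) ⟩
    (G y (x ∷ ys) xor G x (y ∷ ys)) xor E y x ys  ≡⟨ xor-assoc (G y (x ∷ ys)) (G x (y ∷ ys)) (E y x ys) ⟩
    G y (x ∷ ys) xor (G x (y ∷ ys) xor E y x ys)  ∎
    where
    open ≡-Reasoning
    E : A → A → List A → Bool
    E x y = expand (λ z zs → G z (x ∷ y ∷ zs))

-- Signs do not matter in characteristic 2.
det : ∀ s → List (GF2^ s) → Bool
det zero    []      = true
det zero    (_ ∷ _) = false
det (suc s) rs      = expand (λ q qs → head q ∧ det s (List.map tail qs)) rs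

-- The term that picks the first row is additive through `head`, the others by induction. For two
-- equal rows, the two terms picking one of them cancel; every other term keeps both and vanishes by
-- induction.
det-alternating : ∀ s → Alternating (det s)
det-alternating zero = record
  { permute   = λ {us} {vs} σ → det₀ us vs (↭-length σ)
  ; additive  = λ u v ws → refl
  ; alternate = λ u ws → refl
  }
  where
  det₀ : ∀ us vs → length us ≡ length vs → det 0 us ≡ det 0 vs
  det₀ []      []      _ = refl
  det₀ (_ ∷ _) (_ ∷ _) _ = refl
det-alternating (suc s) = record
  { permute   = expand-↭ {G = G} (λ q τ → cong (head q ∧_) (permute (Permₚ.map⁺ tail τ)))
  ; additive  = λ u v ws → trans
      (cong₂ _xor_
        (trans (cong (_∧ det s (List.map tail ws)) (head-⊕ u v)) (∧-distribʳ-xor _ (head u) (head v)))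
        (trans
          (expand-cong (λ q qs → trans
            (cong (head q ∧_) (trans (cong (λ x → det s (x ∷ List.map tail qs)) (tail-⊕ u v)) (additive (tail u) (tail v) _)))
            (∧-distribˡ-xor (head q) _ _)) ws)
          (expand-xor _ _ ws)))
      (xor-interchange (G u ws) (G v ws) _ _)
  ; alternate = λ u ws → trans (sym (xor-assoc (G u (u ∷ ws)) (G u (u ∷ ws)) _)) (cong₂ _xor_ (xor-same (G u (u ∷ ws)))
      (expand-vanishes (All.universal (λ q qs → trans (cong (head q ∧_) (alternate (tail u) (List.map tail qs))) (∧-zeroʳ (head q))) ws)))
  }
  where
  open Alternating (det-alternating s)
  G : GF2^ (suc s) → List (GF2^ (suc s)) → Bool
  G q qs = head q ∧ det s (List.map tail qs)

evaluate : List (GF2^ a → GF2^ b) → GF2^ a → List (GF2^ b)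
evaluate Rs x = List.map (λ R → R x) Rs

-- `G` depends on the point `x` too, because the rows already skipped are absorbed into it.
deg-expand : ∀ d (G : GF2^ a → GF2^ b → List (GF2^ b) → Bool) Rs → All Additive Rs →
             (∀ R Qs → Additive R → All Additive Qs → DegBelow a d (λ x → G x (R x) (evaluate Qs x))) →
             DegBelow a d (λ x → expand (G x) (evaluate Rs x))
deg-expand d G []       []       h = deg-zero _ d (λ _ → refl)
deg-expand d G (R ∷ Rs) (p ∷ ps) h = deg-xor _ d (h R Rs p ps)
  (deg-expand d (λ x y ys → G x y (R x ∷ ys)) Rs ps (λ Q Qs q qs → h Q (R ∷ Qs) q (p ∷ qs)))

-- Each expansion step multiplies a smaller determinant by an entry of degree at most 1, so the
-- degree is at most `s`.
deg-det : ∀ s (Rs : List (GF2^ a → GF2^ s)) → All Additive Rs → DegBelow a (suc s) (λ x → det s (evaluate Rs x))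
deg-det zero    []      _ = deg-const _ 0 true
deg-det zero    (_ ∷ _) _ = deg-const _ 0 false
deg-det (suc s) Rs      p = deg-expand (2 + s) _ Rs p λ R Qs R+ Qs+ →
  deg-∧ _ 1 s (deg-functional _ (λ x y → trans (cong head (R+ x y)) (head-⊕ (R x) (R y))))
    (deg-cong _ (suc s) (λ x → cong (det s) (trans (sym (map-∘ Qs)) (map-∘ Qs)))
      (deg-det s (List.map (tail ∘_) Qs)
        (Allₚ.map⁺ (All.map (λ {Q} Q+ x y → trans (cong tail (Q+ x y)) (tail-⊕ (Q x) (Q y))) Qs+))))

-- Entries are indexed by ℕ so that deleting the first row and column is an index shift. Only the
-- top entry of the first column survives the expansion.
det-triangular : ∀ s (e : ℕ → ℕ → Bool) → (∀ i → i < s → e i i ≡ true) →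
                 (∀ i j → i < s → j < i → e i j ≡ false) →
                 det s (applyUpTo (λ i → tabulate (e i ∘ toℕ)) s) ≡ true
det-triangular zero    e diag low = refl
det-triangular (suc s) e diag low = cong₂ _xor_
  (cong₂ _∧_ (diag 0 (s≤s z≤n))
    (trans (cong (det s) (map-applyUpTo (λ i → tabulate (e (suc i) ∘ toℕ)) tail s))
      (det-triangular s (λ i j → e (suc i) (suc j)) (λ i i< → diag (suc i) (s≤s i<))
        (λ i j i< j< → low (suc i) (suc j) (s≤s i<) (s≤s j<)))))
  (expand-vanishes (Allₚ.applyUpTo⁺₁ (λ i → tabulate (e (suc i) ∘ toℕ)) s
    (λ i< qs → cong (_∧ det s (List.map tail (tabulate (e 0 ∘ toℕ) ∷ qs))) (low _ 0 (s≤s i<) (s≤s z≤n)))))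

-- Systematic form of an injective code

removeAt-⊕ : (u v : GF2^ (suc m)) (p : Fin (suc m)) → removeAt (u ⊕ v) p ≡ removeAt u p ⊕ removeAt v p
removeAt-⊕ (x ∷ u)     (y ∷ v)     zero    = refl
removeAt-⊕ (x ∷ x′ ∷ u) (y ∷ y′ ∷ v) (suc p) = cong (_ ∷_) (removeAt-⊕ (x′ ∷ u) (y′ ∷ v) p)

weight-removeAt : (v : GF2^ (suc m)) (p : Fin (suc m)) → weight v ≡ bit (lookup v p) + weight (removeAt v p)
weight-removeAt (x ∷ v)      zero    = weight-∷ x v
weight-removeAt (x ∷ x′ ∷ v) (suc p) = begin
  weight (x ∷ x′ ∷ v)                                 ≡⟨ weight-∷ x (x′ ∷ v) ⟩
  bit x + weight (x′ ∷ v)                             ≡⟨ cong (bit x +_) (weight-removeAt (x′ ∷ v) p) ⟩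
  bit x + (bit y + weight w)                          ≡⟨ +-leftSwap (bit x) (bit y) (weight w) ⟩
  bit y + (bit x + weight w)                          ≡⟨ cong (bit y +_) (weight-∷ x w) ⟨
  bit y + weight (x ∷ w)                              ∎
  where
  open ≡-Reasoning
  y = lookup (x′ ∷ v) p
  w = removeAt (x′ ∷ v) p

removeAt-𝟘 : (v : GF2^ (suc m)) (p : Fin (suc m)) → lookup v p ≡ false → removeAt v p ≡ 𝟘 → v ≡ 𝟘
removeAt-𝟘 (x ∷ v)      zero    refl refl = refl
removeAt-𝟘 (x ∷ x′ ∷ v) (suc p) vp   eq   =
  cong₂ _∷_ (cong head eq) (removeAt-𝟘 (x′ ∷ v) p vp (cong tail eq))

zero-or-support : (v : GF2^ m) → v ≡ 𝟘 ⊎ ∃ λ p → lookup v p ≡ true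
zero-or-support []          = inj₁ refl
zero-or-support (true ∷ v)  = inj₂ (zero , refl)
zero-or-support (false ∷ v) with zero-or-support v
... | inj₁ refl     = inj₁ refl
... | inj₂ (p , vp) = inj₂ (suc p , vp)

-- info and check sort the coordinates of a word into an information set and the rest.
record Systematic (L : GF2^ n → GF2^ m) : Set where
  field
    redundancy      : ℕ
    length≡         : m ≡ n + redundancy
    encode          : GF2^ n → GF2^ n
    encode-additive : Additive encode
    decode          : GF2^ n → GF2^ n
    encode-decode   : ∀ z → encode (decode z) ≡ z
    info            : GF2^ m → GF2^ n
    info-additive   : Additive info
    check           : GF2^ m → GF2^ redundancy
    check-additive  : Additive check
    weight-split    : ∀ v → weight v ≡ weight (info v) + weight (check v)
    info-encode     : ∀ x → info (L (encode x)) ≡ x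

module EliminateColumn (L : GF2^ (suc n) → GF2^ (suc m)) (L+ : Additive L) (ker : ∀ x → L x ≡ 𝟘 → x ≡ 𝟘)
                       (p : Fin (suc m)) (Le-p : lookup (L (true ∷ 𝟘)) p ≡ true) where

  e : GF2^ (suc n)
  e = true ∷ 𝟘

  lookup-L+ : ∀ x y → lookup (L (x ⊕ y)) p ≡ lookup (L x) p xor lookup (L y) p
  lookup-L+ x y = trans (cong (λ v → lookup v p) (L+ x y)) (lookup-zipWith _xor_ p (L x) (L y))

  μ : GF2^ n → Bool
  μ y = lookup (L (false ∷ y)) p

  -- The first coordinate is chosen to make the codeword vanish at `p`. Thus `L′` is `L` on a
  -- hyperplane, with a coordinate deleted that is always zero there.
  lift : GF2^ n → GF2^ (suc n)
  lift y = μ y ∷ y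

  lift-additive : Additive lift
  lift-additive x y = cong (_∷ (x ⊕ y)) (lookup-L+ (false ∷ x) (false ∷ y))

  lift-p : ∀ y → lookup (L (lift y)) p ≡ false
  lift-p y with μ y in eq
  ... | false = eq
  ... | true  = begin
    lookup (L (true ∷ y)) p                    ≡⟨ cong (λ z → lookup (L (true ∷ z)) p) (⊕-identityˡ y) ⟨
    lookup (L (e ⊕ (false ∷ y))) p             ≡⟨ lookup-L+ e (false ∷ y) ⟩
    lookup (L e) p xor lookup (L (false ∷ y)) p ≡⟨ cong₂ _xor_ Le-p eq ⟩
    false                                      ∎
    where open ≡-Reasoning

  remove+ : Additive (λ x → removeAt (L x) p)
  remove+ x y = trans (cong (λ v → removeAt v p) (L+ x y)) (removeAt-⊕ (L x) (L y) p)

  L′ : GF2^ n → GF2^ m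
  L′ y = removeAt (L (lift y)) p

  L′+ : Additive L′
  L′+ = additive-∘ {f = λ x → removeAt (L x) p} {g = lift} remove+ lift-additive

  ker′ : ∀ y → L′ y ≡ 𝟘 → y ≡ 𝟘
  ker′ y eq = cong tail (ker (lift y) (removeAt-𝟘 (L (lift y)) p (lift-p y) eq))

  extend : Systematic L′ → Systematic L
  extend S = record
    { redundancy      = redundancy
    ; length≡         = cong suc length≡
    ; encode          = enc
    ; encode-additive = enc+
    ; decode          = dec
    ; encode-decode   = enc-dec
    ; info            = λ v → lookup v p ∷ info (removeAt v p)
    ; info-additive   = λ u v → cong₂ _∷_ (lookup-zipWith _xor_ p u v)
        (trans (cong info (removeAt-⊕ u v p)) (info-additive _ _))
    ; check           = λ v → check (removeAt v p)
    ; check-additive  = λ u v → trans (cong check (removeAt-⊕ u v p)) (check-additive _ _)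
    ; weight-split    = weight-split′
    ; info-encode     = info-enc
    }
    where
    open Systematic S
    open ≡-Reasoning

    -- The information part of the codeword of `e`; `enc` adds it before encoding, so that the
    -- contribution of `e` cancels.
    clear : GF2^ n
    clear = info (removeAt (L e) p)

    enc : GF2^ (suc n) → GF2^ (suc n)
    enc x = scale (head x) e ⊕ lift (encode (tail x ⊕ scale (head x) clear))

    scale+ : ∀ {m} (v : GF2^ m) → Additive (λ (x : GF2^ (suc n)) → scale (head x) v)
    scale+ v x y = trans (cong (λ b → scale b v) (head-⊕ x y)) (scale-xor (head x) (head y) v)

    enc+ : Additive enc
    enc+ = additive-⊕ {f = λ x → scale (head x) e} {g = λ x → lift (encode (tail x ⊕ scale (head x) clear))}
      (scale+ e)
      (additive-∘ {f = lift} {g = λ x → encode (tail x ⊕ scale (head x) clear)} lift-additive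
        (additive-∘ {f = encode} {g = λ x → tail x ⊕ scale (head x) clear} encode-additive
          (additive-⊕ {f = tail} {g = λ x → scale (head x) clear} tail-⊕ (scale+ clear))))

    dec : GF2^ (suc n) → GF2^ (suc n)
    dec (z₀ ∷ z) = x₀ ∷ (decode z ⊕ scale x₀ clear)
      where
      -- Compensates for the `μ z` that `lift` puts into the first coordinate.
      x₀ : Bool
      x₀ = z₀ xor μ z

    scale-e : ∀ b → scale b e ≡ b ∷ 𝟘
    scale-e false = refl
    scale-e true  = refl

    enc-dec : ∀ z → enc (dec z) ≡ z
    enc-dec (z₀ ∷ z) = begin
      scale x₀ e ⊕ lift (encode ((decode z ⊕ scale x₀ clear) ⊕ scale x₀ clear))
        ≡⟨ cong (λ y → scale x₀ e ⊕ lift (encode y)) (⊕-cancelʳ (decode z) (scale x₀ clear)) ⟩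
      scale x₀ e ⊕ lift (encode (decode z))
        ≡⟨ cong₂ (λ u y → u ⊕ lift y) (scale-e x₀) (encode-decode z) ⟩
      (x₀ xor μ z) ∷ (𝟘 ⊕ z)
        ≡⟨ cong₂ _∷_ (trans (xor-assoc z₀ (μ z) (μ z)) (trans (cong (z₀ xor_) (xor-same (μ z))) (xor-identityʳ z₀))) (⊕-identityˡ z) ⟩
      z₀ ∷ z ∎
      where
      x₀ : Bool
      x₀ = z₀ xor μ z

    weight-split′ : ∀ v → weight v ≡ weight (lookup v p ∷ info (removeAt v p)) + weight (check (removeAt v p))
    weight-split′ v = begin
      weight v                                     ≡⟨ weight-removeAt v p ⟩
      bit (lookup v p) + weight w                  ≡⟨ cong (bit (lookup v p) +_) (weight-split w) ⟩
      bit (lookup v p) + (weight (info w) + weight (check w))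
        ≡⟨ +-assoc (bit (lookup v p)) (weight (info w)) (weight (check w)) ⟨
      bit (lookup v p) + weight (info w) + weight (check w)
        ≡⟨ cong (_+ weight (check w)) (weight-∷ (lookup v p) (info w)) ⟨
      weight (lookup v p ∷ info w) + weight (check w) ∎
      where
      w : GF2^ m
      w = removeAt v p

    info-enc : ∀ x → lookup (L (enc x)) p ∷ info (removeAt (L (enc x)) p) ≡ x
    info-enc (false ∷ y) = cong₂ _∷_
      (trans (cong (λ z → lookup (L z) p) enc≡) (lift-p (encode y)))
      (trans (cong (λ z → info (removeAt (L z) p)) enc≡) (info-encode y))
      where
      enc≡ : enc (false ∷ y) ≡ lift (encode y)
      enc≡ = trans (⊕-identityˡ _) (cong (lift ∘ encode) (⊕-identityʳ y))
    info-enc (true ∷ y) = cong₂ _∷_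
      (trans (lookup-L+ e (lift w)) (cong₂ _xor_ Le-p (lift-p w)))
      (begin
        info (removeAt (L (e ⊕ lift w)) p)        ≡⟨ cong info (remove+ e (lift w)) ⟩
        info (removeAt (L e) p ⊕ L′ w)            ≡⟨ info-additive _ _ ⟩
        clear ⊕ info (L′ w)                       ≡⟨ cong (clear ⊕_) (info-encode (y ⊕ clear)) ⟩
        clear ⊕ (y ⊕ clear)                       ≡⟨ ⊕-comm clear (y ⊕ clear) ⟩
        (y ⊕ clear) ⊕ clear                       ≡⟨ ⊕-cancelʳ y clear ⟩
        y                                         ∎)
      where
      w : GF2^ n
      w = encode (y ⊕ clear)

-- Gaussian elimination, one input coordinate at a time: by injectivity the image of the first unit
-- vector is nonzero, and a coordinate in its support becomes the next information position.
systematic : ∀ n {m} (L : GF2^ n → GF2^ m) → Additive L → (∀ x → L x ≡ 𝟘 → x ≡ 𝟘) → Systematic L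
systematic zero {m} L L+ ker = record
  { redundancy      = m
  ; length≡         = refl
  ; encode          = id
  ; encode-additive = λ x y → refl
  ; decode          = id
  ; encode-decode   = λ z → refl
  ; info            = λ _ → []
  ; info-additive   = λ x y → refl
  ; check           = id
  ; check-additive  = λ x y → refl
  ; weight-split    = λ v → refl
  ; info-encode     = λ { [] → refl }
  }
systematic (suc n) {m} L L+ ker with zero-or-support (L (true ∷ 𝟘))
... | inj₁ Le≡𝟘 with ker _ Le≡𝟘
...   | ()
systematic (suc n) {suc m} L L+ ker | inj₂ (p , Le-p) = extend (systematic n L′ L′+ ker′)
  where open EliminateColumn L L+ ker p Le-p

-- Minors and banded Toeplitz matrices

-- Out-of-range indices give the default d.
at : {A : Set} → A → Vec A n → ℕ → A
at d []       i       = d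
at d (x ∷ xs) zero    = x
at d (x ∷ xs) (suc i) = at d xs i

module _ {A : Set} where

  at-zipWith : (f : A → A → A) (d : A) → f d d ≡ d → (xs ys : Vec A n) → ∀ i →
               at d (zipWith f xs ys) i ≡ f (at d xs i) (at d ys i)
  at-zipWith f d dd []       []       i       = sym dd
  at-zipWith f d dd (x ∷ xs) (y ∷ ys) zero    = refl
  at-zipWith f d dd (x ∷ xs) (y ∷ ys) (suc i) = at-zipWith f d dd xs ys i

  at-tabulate : ∀ n (d : A) (f : ℕ → A) {i} → i < n → at d (tabulate {n = n} (f ∘ toℕ)) i ≡ f i
  at-tabulate (suc n) d f {zero}  _         = refl
  at-tabulate (suc n) d f {suc i} (s≤s i<n) = at-tabulate n d (f ∘ suc) i<n

  at-All : {P : A → Set} {d : A} → P d → (xs : Vec A n) → All P (toList xs) → ∀ i → P (at d xs i)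
  at-All pd []       []       i       = pd
  at-All pd (x ∷ xs) (p ∷ ps) zero    = p
  at-All pd (x ∷ xs) (p ∷ ps) (suc i) = at-All pd xs ps i

  tabulate-zipWith : ∀ {n} (f : A → A → A) {g h l : Fin n → A} → (∀ i → l i ≡ f (g i) (h i)) →
                     tabulate l ≡ zipWith f (tabulate g) (tabulate h)
  tabulate-zipWith {zero}  f eq = refl
  tabulate-zipWith {suc n} f eq = cong₂ _∷_ (eq zero) (tabulate-zipWith f (eq ∘ suc))

window : ∀ t s → GF2^ n → GF2^ s
window t s v = tabulate (λ j → at false v (t + toℕ j))

window-additive : ∀ t s → Additive (window {n} t s)
window-additive t s u v = tabulate-zipWith _xor_ (λ j → at-zipWith _xor_ false refl u v (t + toℕ j))

-- Rows 0 … s - 1 and columns t … t + s - 1.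
minor : ∀ t s → Mat n → Bool
minor t s A = det s (applyUpTo (λ i → window t s (at 𝟘 A i)) s)

-- Composed with `window`, the determinant is an alternating form in the full rows. If the rank were
-- below `s`, its `s` arguments would lie in the span of fewer than `s` vectors.
minor≤rank : ∀ t s (A : Mat n) → minor t s A ≡ true → s ≤ rank A
minor≤rank {n} t s A eq with rows-spanned n (toList A)
... | B , len , spn = ≮⇒≥ λ r<s → true≢false (trans (sym eq) (begin
  det s (applyUpTo (λ i → window t s (at 𝟘 A i)) s)        ≡⟨ cong (det s) (map-applyUpTo (at 𝟘 A) (window t s) s) ⟨
  det s (List.map (window t s) (applyUpTo (at 𝟘 A) s))
    ≡⟨ alternating-vanishes B (alternating-map (det-alternating s) (window-additive t s)) (applyUpTo (at 𝟘 A) s)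
         -- An index past the last row gives `𝟘`, which lies in every span.
         (Allₚ.applyUpTo⁺₂ (at 𝟘 A) s (at-All (inSpan-𝟘 B) A spn)) (length-applyUpTo (at 𝟘 A) s)
         (subst (_< s) (sym len) r<s) ⟩
  false ∎))
  where
  open ≡-Reasoning
  true≢false : true ≡ false → ⊥
  true≢false ()

deg-minor : ∀ t s (A : GF2^ a → Mat n) → (∀ x y → A (x ⊕ y) ≡ A x ⊞ A y) → DegBelow a (suc s) (λ x → minor t s (A x))
deg-minor t s A A+ = deg-cong _ (suc s)
  (λ x → cong (det s) (map-applyUpTo row (λ R → R x) s))
  (deg-det s (applyUpTo row s) (Allₚ.applyUpTo⁺₂ row s λ i x y →
    trans (cong (window t s) (trans (cong (λ M → at 𝟘 M i) (A+ x y)) (at-zipWith _⊕_ 𝟘 (⊕-self 𝟘) (A x) (A y) i)))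
      (window-additive t s (at 𝟘 (A x) i) (at 𝟘 (A y) i))))
  where
  row : ℕ → GF2^ _ → GF2^ s
  row i x = window t s (at 𝟘 (A x) i)

-- The entry g(j - i), or `false` for j < i, by recursion instead of truncated subtraction.
shifted : (ℕ → Bool) → ℕ → ℕ → Bool
shifted g zero    j       = g j
shifted g (suc i) zero    = false
shifted g (suc i) (suc j) = shifted g i j

shifted-diagonal : ∀ g t i → shifted g i (t + i) ≡ g t
shifted-diagonal g t zero    = cong g (+-identityʳ t)
shifted-diagonal g t (suc i) = trans (cong (shifted g (suc i)) (+-suc t i)) (shifted-diagonal g t i)

shifted-below : ∀ g t → (∀ u → u < t → g u ≡ false) → ∀ i j → j < i → shifted g i (t + j) ≡ false
shifted-below g t low (suc i) (suc j) (s≤s j<i) =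
  trans (cong (shifted g (suc i)) (+-suc t j)) (shifted-below g t low i j j<i)
shifted-below g t low (suc i) zero _ rewrite +-identityʳ t = go i t low
  where
  go : ∀ i t → (∀ u → u < t → g u ≡ false) → shifted g (suc i) t ≡ false
  go i       zero    _   = refl
  go zero    (suc t) low = low t ≤-refl
  go (suc i) (suc t) low = go i t (λ u u<t → low u (m≤n⇒m≤1+n u<t))

toeplitz : ∀ n → Vec Bool k → Mat n
toeplitz n c = tabulate (λ i → tabulate (λ j → shifted (at false c) (toℕ i) (toℕ j)))

shifted-xor : (g h l : ℕ → Bool) → (∀ i → l i ≡ g i xor h i) → ∀ i j → shifted l i j ≡ shifted g i j xor shifted h i j
shifted-xor g h l eq zero    j       = eq j
shifted-xor g h l eq (suc i) zero    = refl
shifted-xor g h l eq (suc i) (suc j) = shifted-xor g h l eq i j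

toeplitz-⊞ : ∀ n (c d : Vec Bool k) → toeplitz n (c ⊕ d) ≡ toeplitz n c ⊞ toeplitz n d
toeplitz-⊞ n c d = tabulate-zipWith _⊕_ (λ i → tabulate-zipWith _xor_ (λ j →
  shifted-xor (at false c) (at false d) (at false (c ⊕ d)) (at-zipWith _xor_ false refl c d) (toℕ i) (toℕ j)))

-- Also the offset of the first nonzero diagonal of the Toeplitz matrix; `nothing` occurs exactly
-- for the zero vector.
lead : Vec Bool k → Maybe ℕ
lead []          = nothing
lead (true ∷ c)  = just 0
lead (false ∷ c) = Maybe.map suc (lead c)

lead-spec : (c : Vec Bool k) → ∀ {t} → lead c ≡ just t →
            t < k × at false c t ≡ true × (∀ u → u < t → at false c u ≡ false)
lead-spec (true ∷ c)  refl = s≤s z≤n , refl , λ u ()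
lead-spec (false ∷ c) eq with lead c in eq′
lead-spec (false ∷ c) refl | just t with lead-spec c eq′
... | t<k , ct , low = s≤s t<k , ct , λ { zero _ → refl ; (suc u) (s≤s u<t) → low u u<t }

-- From column `t` on, the block is upper triangular with the leading coefficient on its diagonal.
-- It fits into the matrix because `t < k`.
minor-toeplitz : ∀ n (c : Vec Bool k) {t} → lead c ≡ just t → minor t (n ∸ k) (toeplitz n c) ≡ true
minor-toeplitz {k} n c {t} eq with lead-spec c eq
... | t<k , ct , low = det-triangular s (λ i j → at false (at 𝟘 (toeplitz n c) i) (t + j))
  (λ i i<s → trans (entry i i i<s i<s) (trans (shifted-diagonal g t i) ct))
  (λ i j i<s j<i → trans (entry i j i<s (<-trans j<i i<s)) (shifted-below g t low i j j<i))
  where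
  s = n ∸ k
  g = at false c
  entry : ∀ i j → i < s → j < s → at false (at 𝟘 (toeplitz n c) i) (t + j) ≡ shifted g i (t + j)
  entry i j i<s j<s = trans
    (cong (λ r → at false r (t + j)) (at-tabulate n 𝟘 (λ i → tabulate (shifted g i ∘ toℕ)) (<-≤-trans i<s (m∸n≤m n k))))
    (at-tabulate n false (shifted g i)
      (<-≤-trans (+-mono-<-≤ t<k (<⇒≤ j<s)) (≤-reflexive (m+[n∸m]≡n k≤n))))
    where
    k≤n : k ≤ n
    -- There is an index below `n ∸ k`, so this difference is not truncated.
    k≤n = <⇒≤ (m∸n≢0⇒n<m {n} {k} (λ s≡0 → n≮0 (subst (i <_) s≡0 i<s)))

-- Sums and products over GF(2)^k

sumCube : ∀ k → (Vec Bool k → ℕ) → ℕ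
sumCube zero    f = f []
sumCube (suc k) f = sumCube k (f ∘ (false ∷_)) + sumCube k (f ∘ (true ∷_))

sumCube-cong : ∀ k {f g : Vec Bool k → ℕ} → (∀ c → f c ≡ g c) → sumCube k f ≡ sumCube k g
sumCube-cong zero    eq = eq []
sumCube-cong (suc k) eq = cong₂ _+_ (sumCube-cong k (eq ∘ (false ∷_))) (sumCube-cong k (eq ∘ (true ∷_)))

sumCube-mono : ∀ k {f g : Vec Bool k → ℕ} → (∀ c → f c ≤ g c) → sumCube k f ≤ sumCube k g
sumCube-mono zero    le = le []
sumCube-mono (suc k) le = +-mono-≤ (sumCube-mono k (le ∘ (false ∷_))) (sumCube-mono k (le ∘ (true ∷_)))

sumCube-+ : ∀ k (f g : Vec Bool k → ℕ) → sumCube k (λ c → f c + g c) ≡ sumCube k f + sumCube k g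
sumCube-+ zero    f g = refl
sumCube-+ (suc k) f g = trans (cong₂ _+_ (sumCube-+ k _ _) (sumCube-+ k _ _))
  (+-interchange (sumCube k (f ∘ (false ∷_))) _ _ _)

double-* : ∀ p w → p * w + p * w ≡ (p + (p + 0)) * w
double-* = solve-∀

sumCube-const : ∀ k w → sumCube k (λ _ → w) ≡ 2 ^ k * w
sumCube-const zero    w = sym (*-identityˡ w)
sumCube-const (suc k) w = trans (cong₂ _+_ (sumCube-const k w) (sumCube-const k w)) (double-* (2 ^ k) w)

-- Every coefficient vector except zero has a `lead`; the extra `w` stands for the zero vector and
-- avoids a subtraction.
sumCube-lead : ∀ k w → sumCube k (λ c → maybe (λ _ → w) 0 (lead c)) + w ≡ 2 ^ k * w
sumCube-lead zero    w = sym (+-identityʳ w)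
sumCube-lead (suc k) w = begin
  sumCube k (λ c → maybe (λ _ → w) 0 (Maybe.map suc (lead c))) + sumCube k (λ _ → w) + w
    ≡⟨ cong₂ (λ x y → x + y + w) (sumCube-cong k (λ c → maybe-map (lead c))) (sumCube-const k w) ⟩
  S + 2 ^ k * w + w    ≡⟨ rearrange S (2 ^ k * w) w ⟩
  (S + w) + 2 ^ k * w  ≡⟨ cong (_+ 2 ^ k * w) (sumCube-lead k w) ⟩
  2 ^ k * w + 2 ^ k * w ≡⟨ double-* (2 ^ k) w ⟩
  2 ^ suc k * w ∎
  where
  open ≡-Reasoning
  S = sumCube k (λ c → maybe (λ _ → w) 0 (lead c))
  rearrange : ∀ x y z → x + y + z ≡ (x + z) + y
  rearrange = solve-∀
  maybe-map : ∀ (x : Maybe ℕ) → maybe (λ _ → w) 0 (Maybe.map suc x) ≡ maybe (λ _ → w) 0 x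
  maybe-map nothing  = refl
  maybe-map (just _) = refl

dot : Vec Bool k → Vec Bool k → Bool
dot []       []       = false
dot (c ∷ cs) (b ∷ bs) = (c ∧ b) xor dot cs bs

-- If an entry of `bs` is `true`, flipping the matching coefficient flips the dot product, so
-- exactly half of the vectors give `true`; otherwise none do.
sumCube-dot : ∀ k (bs : Vec Bool k) → 2 * sumCube k (λ c → bit (dot c bs)) ≤ 2 ^ k
sumCube-dot zero    []           = z≤n
sumCube-dot (suc k) (false ∷ bs) = begin
  2 * (S + S)     ≡⟨ *-distribˡ-+ 2 S S ⟩
  2 * S + 2 * S   ≤⟨ +-mono-≤ (sumCube-dot k bs) (≤-trans (sumCube-dot k bs) (m≤m+n (2 ^ k) 0)) ⟩
  2 ^ suc k       ∎
  where
  open ≤-Reasoning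
  S = sumCube k (λ c → bit (dot c bs))
sumCube-dot (suc k) (true ∷ bs) = ≤-reflexive (cong (2 *_) (begin
  sumCube k (λ c → bit (dot c bs)) + sumCube k (λ c → bit (not (dot c bs)))  ≡⟨ sumCube-+ k _ _ ⟨
  sumCube k (λ c → bit (dot c bs) + bit (not (dot c bs)))                    ≡⟨ sumCube-cong k (λ c → complement (dot c bs)) ⟩
  sumCube k (λ _ → 1)                                                        ≡⟨ sumCube-const k 1 ⟩
  2 ^ k * 1                                                                  ≡⟨ *-identityʳ (2 ^ k) ⟩
  2 ^ k                                                                      ∎))
  where
  open ≡-Reasoning
  complement : ∀ b → bit b + bit (not b) ≡ 1
  complement true  = refl
  complement false = refl

comb-∷ : (cs : Vec Bool k) (vs : Vec (GF2^ (suc m)) k) →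
         comb cs vs ≡ dot cs (Vec.map head vs) ∷ comb cs (Vec.map tail vs)
comb-∷ []           []             = refl
comb-∷ (false ∷ cs) ((x ∷ v) ∷ vs) = cong (𝟘 ⊕_) (comb-∷ cs vs)
comb-∷ (true ∷ cs)  ((x ∷ v) ∷ vs) = cong ((x ∷ v) ⊕_) (comb-∷ cs vs)

-- Each coordinate vanishes on at least half of the combinations.
sumCube-weight-comb : ∀ k m (vs : Vec (GF2^ m) k) → 2 * sumCube k (λ c → weight (comb c vs)) ≤ 2 ^ k * m
sumCube-weight-comb k zero    vs = ≤-reflexive (trans
  (cong (2 *_) (trans (sumCube-cong k (λ c → weight-[] (comb c vs))) (trans (sumCube-const k 0) (*-zeroʳ (2 ^ k)))))
  (sym (*-zeroʳ (2 ^ k))))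
  where
  weight-[] : (v : GF2^ 0) → weight v ≡ 0
  weight-[] [] = refl
sumCube-weight-comb k (suc m) vs = begin
  2 * sumCube k (λ c → weight (comb c vs))
    ≡⟨ cong (2 *_) (trans (sumCube-cong k (λ c → trans (cong weight (comb-∷ c vs)) (weight-∷ (dot c hs) (comb c ts)))) (sumCube-+ k _ _)) ⟩
  2 * (sumCube k (λ c → bit (dot c hs)) + sumCube k (λ c → weight (comb c ts)))
    ≡⟨ *-distribˡ-+ 2 (sumCube k (λ c → bit (dot c hs))) _ ⟩
  2 * sumCube k (λ c → bit (dot c hs)) + 2 * sumCube k (λ c → weight (comb c ts))
    ≤⟨ +-mono-≤ (sumCube-dot k hs) (sumCube-weight-comb k m ts) ⟩
  2 ^ k + 2 ^ k * m
    ≡⟨ *-suc (2 ^ k) m ⟨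
  2 ^ k * suc m ∎
  where
  open ≤-Reasoning
  hs = Vec.map head vs
  ts = Vec.map tail vs

allCube : ∀ k → (Vec Bool k → Bool) → Bool
allCube zero    f = f []
allCube (suc k) f = allCube k (f ∘ (false ∷_)) ∧ allCube k (f ∘ (true ∷_))

allCube⁺ : ∀ k {f : Vec Bool k → Bool} → (∀ c → f c ≡ true) → allCube k f ≡ true
allCube⁺ zero    p = p []
allCube⁺ (suc k) p = cong₂ _∧_ (allCube⁺ k (p ∘ (false ∷_))) (allCube⁺ k (p ∘ (true ∷_)))

∧-true : ∀ x y → x ∧ y ≡ true → x ≡ true × y ≡ true
∧-true true true refl = refl , refl

allCube⁻ : ∀ k {f : Vec Bool k → Bool} → allCube k f ≡ true → ∀ c → f c ≡ true
allCube⁻ zero    p []          = p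
allCube⁻ (suc k) p (false ∷ c) = allCube⁻ k (proj₁ (∧-true _ _ p)) c
allCube⁻ (suc k) p (true ∷ c)  = allCube⁻ k (proj₂ (∧-true _ _ p)) c

deg-allCube : ∀ k d {g : Vec Bool k → GF2^ m → Bool} → (∀ c → DegBelow m (suc d) (g c)) →
              DegBelow m (suc (2 ^ k * d)) (λ x → allCube k (λ c → g c x))
deg-allCube {m} zero    d {g} p = subst (λ e → DegBelow m (suc e) (g [])) (sym (*-identityˡ d)) (p [])
deg-allCube {m} (suc k) d {g} p =
  subst (λ e → DegBelow m (suc e) (λ x → allCube (suc k) (λ c → g c x))) (double-* (2 ^ k) d)
    (deg-∧ m (2 ^ k * d) (2 ^ k * d) (deg-allCube k d (p ∘ (false ∷_))) (deg-allCube k d (p ∘ (true ∷_))))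

-- The lower bound

module _ (n m : ℕ) (1≤n : 1 ≤ n) (Γ : Mat n → GF2^ m) (code : IsLinearCodeOfMatrices n m Γ) where
  open IsLinearCodeOfMatrices code

  flatΓ : GF2^ (n * n) → GF2^ m
  flatΓ x = Γ (blocks n x)

  flatΓ-additive : Additive flatΓ
  flatΓ-additive x y = trans (cong Γ (blocks-⊕ n x y)) (additive (blocks n x) (blocks n y))

  -- Rank 0 leaves no spanning vectors, so all rows vanish; positive rank forces weight at least
  -- `n`, which is positive.
  flatΓ-injective : ∀ x → flatΓ x ≡ 𝟘 → x ≡ 𝟘
  flatΓ-injective x eq with rows-spanned n (toList (blocks n x))
  ... | []    , len , spn = blocks-𝟘 n x spn
  ... | _ ∷ _ , len , spn = ⊥-elim (<⇒≱ (*-mono-≤ 1≤n (≤-trans (s≤s z≤n) (≤-reflexive len)))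
    (≤-trans (rankBound (blocks n x)) (≤-reflexive (trans (cong weight eq) (weight-𝟘 m)))))

  open Systematic (systematic (n * n) flatΓ flatΓ-additive flatΓ-injective)

  module _ (k : ℕ) where

    s : ℕ
    s = n ∸ k

    test : Maybe ℕ → Mat n → Bool
    test nothing  A = true
    test (just t) A = minor t s A

    -- A point `x` holds the coefficients of `k` matrices in the basis given by `encode`, so weights
    -- are counted before encoding.
    combination : Vec Bool k → GF2^ (k * (n * n)) → GF2^ (n * n)
    combination c x = comb c (blocks k x)

    matrix : Vec Bool k → GF2^ (k * (n * n)) → Mat n
    matrix c x = blocks n (encode (combination c x))

    matrix-⊞ : ∀ c x y → matrix c (x ⊕ y) ≡ matrix c x ⊞ matrix c y
    matrix-⊞ c x y = trans
      (cong (blocks n) (trans (cong encode (trans (cong (comb c) (blocks-⊕ k x y)) (comb-⊕ c (blocks k x) (blocks k y))))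
        (encode-additive _ _)))
      (blocks-⊕ n (encode (combination c x)) (encode (combination c y)))

    allTests : GF2^ (k * (n * n)) → Bool
    allTests x = allCube k (λ c → test (lead c) (matrix c x))

    deg-test : ∀ l c → DegBelow (k * (n * n)) (suc s) (λ x → test l (matrix c x))
    deg-test nothing  c = deg-const _ s true
    deg-test (just t) c = deg-minor t s (matrix c) (matrix-⊞ c)

    -- The point is the tuple of Toeplitz generators, pulled back through `decode`. Its weight is
    -- not controlled; it shows that `allTests` is not the zero function, so that `sparse-witness`
    -- can supply a light point.
    dense-witness : ∃ λ x → allTests x ≡ true
    dense-witness with additive-as-comb {k} (λ c → concat (toeplitz n c))
      (λ c d → trans (cong concat (toeplitz-⊞ n c d)) (concat-⊕ (toeplitz n c) (toeplitz n d)))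
    ... | vs , comb-vs = x , allCube⁺ k (λ c → passes c (lead c) refl)
      where
      open ≡-Reasoning
      x : GF2^ (k * (n * n))
      x = concat (Vec.map decode vs)
      encode-decode* : ∀ {k} (vs : Vec (GF2^ (n * n)) k) → Vec.map encode (Vec.map decode vs) ≡ vs
      encode-decode* []       = refl
      encode-decode* (v ∷ vs) = cong₂ _∷_ (encode-decode v) (encode-decode* vs)
      matrix-x : ∀ c → matrix c x ≡ toeplitz n c
      matrix-x c = begin
        blocks n (encode (comb c (blocks k x)))              ≡⟨ cong (blocks n ∘ encode ∘ comb c) (blocks-concat (Vec.map decode vs)) ⟩
        blocks n (encode (comb c (Vec.map decode vs)))       ≡⟨ cong (blocks n) (additive-comb encode-additive c (Vec.map decode vs)) ⟩
        blocks n (comb c (Vec.map encode (Vec.map decode vs))) ≡⟨ cong (blocks n ∘ comb c) (encode-decode* vs) ⟩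
        blocks n (comb c vs)                                 ≡⟨ cong (blocks n) (comb-vs c) ⟩
        blocks n (concat (toeplitz n c))                     ≡⟨ blocks-concat (toeplitz n c) ⟩
        toeplitz n c                                         ∎
      passes : ∀ c l → lead c ≡ l → test l (matrix c x) ≡ true
      passes c nothing  _  = refl
      passes c (just t) eq = trans (cong (minor t s) (matrix-x c)) (minor-toeplitz n c eq)

    -- Double counting of the total weight of the codewords of all combinations. The factor 2 clears
    -- the half from the redundant coordinates, and `2 * (n * s)` makes up for the zero combination.
    redundancy-bound : 2 * (2 ^ k * (n * s)) ≤ 2 * (n * s) + 2 * (2 ^ k * (2 ^ k * n)) + 2 ^ k * redundancy
    redundancy-bound
      with sparse-witness _ _ (deg-allCube k s (λ c → deg-test (lead c) c)) (proj₁ dense-witness) (proj₂ dense-witness)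
    ... | x , s≤s light , passes = begin
      2 * (2 ^ k * w)                                         ≡⟨ cong (2 *_) (sumCube-lead k w) ⟨
      2 * (sumCube k (λ c → maybe (λ _ → w) 0 (lead c)) + w)  ≤⟨ *-monoʳ-≤ 2 (+-monoˡ-≤ w (≤-trans (sumCube-mono k heavy) (≤-reflexive (sumCube-+ k _ _)))) ⟩
      2 * ((I + J) + w)                                       ≡⟨ rearrange I J w ⟩
      2 * w + 2 * I + 2 * J                                   ≤⟨ +-mono-≤ (+-monoʳ-≤ (2 * w) (*-monoʳ-≤ 2 I≤)) J≤ ⟩
      2 * w + 2 * (2 ^ k * (2 ^ k * n)) + 2 ^ k * redundancy  ∎
      where
      open ≤-Reasoning
      w = n * s
      parity : GF2^ (n * n) → GF2^ redundancy
      parity y = check (flatΓ (encode y))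
      parity+ : Additive parity
      parity+ = additive-∘ {f = check} {g = flatΓ ∘ encode} check-additive
        (additive-∘ {f = flatΓ} {g = encode} flatΓ-additive encode-additive)
      I = sumCube k (λ c → weight (combination c x))
      J = sumCube k (λ c → weight (comb c (Vec.map parity (blocks k x))))
      rearrange : ∀ i j w → 2 * ((i + j) + w) ≡ 2 * w + 2 * i + 2 * j
      rearrange = solve-∀
      -- On the information set the codeword is the coefficient vector itself; elsewhere it is a
      -- combination of the parity words of the `k` blocks.
      full : ∀ c → weight (flatΓ (encode (combination c x))) ≡
                   weight (combination c x) + weight (comb c (Vec.map parity (blocks k x)))
      full c = trans (weight-split _) (cong₂ _+_ (cong weight (info-encode (combination c x)))
        (cong weight (additive-comb {f = parity} parity+ c (blocks k x))))
      rank-lead : ∀ c l → test l (matrix c x) ≡ true → maybe (λ _ → w) 0 l ≤ n * rank (matrix c x)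
      rank-lead c nothing  _ = z≤n
      rank-lead c (just t) p = *-monoʳ-≤ n (minor≤rank t s (matrix c x) p)
      heavy : ∀ c → maybe (λ _ → w) 0 (lead c) ≤ weight (combination c x) + weight (comb c (Vec.map parity (blocks k x)))
      heavy c = ≤-trans (rank-lead c (lead c) (allCube⁻ k passes c))
        (≤-trans (rankBound (matrix c x)) (≤-reflexive (full c)))
      -- Every combination is supported on the union of the supports of the `k` blocks, so its
      -- weight is at most that of `x`.
      I≤ : I ≤ 2 ^ k * (2 ^ k * n)
      I≤ = ≤-trans
        (sumCube-mono k (λ c → ≤-trans (weight-comb c (blocks k x)) (≤-trans (≤-reflexive (total-weight-blocks k x))
          (≤-trans light (*-monoʳ-≤ (2 ^ k) (m∸n≤m n k))))))
        (≤-reflexive (sumCube-const k (2 ^ k * n)))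
      J≤ : 2 * J ≤ 2 ^ k * redundancy
      J≤ = sumCube-weight-comb k redundancy (Vec.map parity (blocks k x))

    -- With `K = 2 ^ k`, the three error terms 2 n s, 2 K² n and 2 n K k are each at most 2 n², by
    -- `K²≤n` and `k≤K`.
    deficit-bound : 2 ^ k * 2 ^ k ≤ n → 2 ^ k * (3 * n ^ 2 ∸ m) ≤ 6 * (n * n)
    deficit-bound K²≤n = begin
      K * (3 * n ^ 2 ∸ m)                                     ≡⟨ *-distribˡ-∸ K (3 * n ^ 2) m ⟩
      K * (3 * n ^ 2) ∸ K * m                                 ≤⟨ m≤n+o⇒m∸n≤o (K * (3 * n ^ 2)) (K * m) K*3n² ⟩
      6 * (n * n)                                             ∎
      where
      open ≤-Reasoning
      K = 2 ^ k
      k≤K : k ≤ K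
      k≤K = <⇒≤ (n<2^n k)
        where
        n<2^n : ∀ k → k < 2 ^ k
        n<2^n zero    = s≤s z≤n
        n<2^n (suc k) = +-mono-≤ (≤-trans (s≤s z≤n) (n<2^n k)) (≤-trans (n<2^n k) (m≤m+n (2 ^ k) 0))
      expand₃ : ∀ K n → K * (3 * (n * (n * 1))) ≡ K * (n * n) + 2 * (K * (n * n))
      expand₃ = solve-∀
      split : ∀ K n k s → 2 * (K * (n * (k + s))) ≡ 2 * (K * (n * s)) + 2 * (n * (K * k))
      split = solve-∀
      collect : ∀ K n r → K * (n * n) + (2 * (n * n) + 2 * (n * n) + K * r + 2 * (n * n)) ≡ K * (n * n + r) + 6 * (n * n)
      collect = solve-∀
      K*3n² : K * (3 * n ^ 2) ≤ K * m + 6 * (n * n)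
      K*3n² = begin
        K * (3 * n ^ 2)
          ≡⟨ expand₃ K n ⟩
        K * (n * n) + 2 * (K * (n * n))
          ≤⟨ +-monoʳ-≤ (K * (n * n)) (*-monoʳ-≤ 2 (*-monoʳ-≤ K (*-monoʳ-≤ n (m≤n+m∸n n k)))) ⟩
        K * (n * n) + 2 * (K * (n * (k + s)))
          ≡⟨ cong (K * (n * n) +_) (split K n k s) ⟩
        K * (n * n) + (2 * (K * (n * s)) + 2 * (n * (K * k)))
          ≤⟨ +-monoʳ-≤ (K * (n * n)) (+-mono-≤ redundancy-bound (*-monoʳ-≤ 2 (*-monoʳ-≤ n (≤-trans (*-monoʳ-≤ K k≤K) K²≤n)))) ⟩
        K * (n * n) + (2 * (n * s) + 2 * (K * (K * n)) + K * redundancy + 2 * (n * n))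
          ≤⟨ +-monoʳ-≤ (K * (n * n)) (+-monoˡ-≤ (2 * (n * n)) (+-monoˡ-≤ (K * redundancy)
               (+-mono-≤ (*-monoʳ-≤ 2 (*-monoʳ-≤ n (m∸n≤m n k)))
                 (*-monoʳ-≤ 2 (≤-trans (≤-reflexive (sym (*-assoc K K n))) (*-monoˡ-≤ n K²≤n)))))) ⟩
        K * (n * n) + (2 * (n * n) + 2 * (n * n) + K * redundancy + 2 * (n * n))
          ≡⟨ collect K n redundancy ⟩
        K * (n * n + redundancy) + 6 * (n * n)
          ≡⟨ cong (λ l → K * l + 6 * (n * n)) length≡ ⟨
        K * m + 6 * (n * n) ∎

-- Choice of the band width and the exponent 5/3

log₈ : ∀ n → 1 ≤ n → ∃ λ k → 8 ^ k ≤ n × n < 8 ^ suc k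
log₈ (suc zero)    _ = 0 , s≤s z≤n , s≤s (s≤s z≤n)
log₈ (suc (suc n)) _ with log₈ (suc n) (s≤s z≤n)
... | k , lo , hi with 2 + n <? 8 ^ suc k
...   | yes lt = k , m≤n⇒m≤1+n lo , lt
...   | no ≮   = suc k , ≮⇒≥ ≮ , ≤-<-trans hi (^-monoʳ-< 8 (s≤s (s≤s z≤n)) (n<1+n (suc k)))

cube-2^ : ∀ k → 2 ^ k * (2 ^ k * 2 ^ k) ≡ 8 ^ k
cube-2^ zero    = refl
cube-2^ (suc k) = trans (double³ (2 ^ k)) (cong (8 *_) (cube-2^ k))
  where
  double³ : ∀ x → (2 * x) * ((2 * x) * (2 * x)) ≡ 8 * (x * (x * x))
  double³ = solve-∀

-- Cubing `K * E ≤ 6 * (n * n)` and using n ≤ 8 K³ gives n E³ ≤ 8 (6 n²)³ = n · 12³ n⁵. The constant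
-- is 12 = 2 · 6, with 2 the cube root of 8.
cube-bound : ∀ n K E → 1 ≤ n → n ≤ 8 * (K * (K * K)) → K * E ≤ 6 * (n * n) → E ^ 3 ≤ 12 ^ 3 * n ^ 5
cube-bound n@(suc _) K E _ n≤8K³ KE≤6n² = *-cancelˡ-≤ n (begin
  n * E ^ 3                                      ≤⟨ *-monoˡ-≤ (E ^ 3) n≤8K³ ⟩
  8 * (K * (K * K)) * E ^ 3                      ≡⟨ regroup K E ⟩
  8 * (K * E * (K * E * (K * E)))                ≤⟨ *-monoʳ-≤ 8 (*-mono-≤ KE≤6n² (*-mono-≤ KE≤6n² KE≤6n²)) ⟩
  8 * (6 * (n * n) * (6 * (n * n) * (6 * (n * n)))) ≡⟨ powers n ⟩
  n * (12 ^ 3 * n ^ 5)                           ∎)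
  where
  open ≤-Reasoning
  regroup : ∀ K E → 8 * (K * (K * K)) * (E * (E * (E * 1))) ≡ 8 * (K * E * (K * E * (K * E)))
  regroup = solve-∀
  powers : ∀ n → 8 * (6 * (n * n) * (6 * (n * n) * (6 * (n * n)))) ≡ n * (1728 * (n * (n * (n * (n * (n * 1))))))
  powers = solve-∀

-- The inequality is cubed to clear the exponent 5/3. The truncated difference is 0 once m ≥ 3 n²,
-- where the claim is trivial.
theorem3 : ∃ λ (C : ℕ) → ∀ (n m : ℕ) → 1 ≤ n → (Γ : Mat n → GF2^ m) → IsLinearCodeOfMatrices n m Γ → (3 * n ^ 2 ∸ m) ^ 3 ≤ C ^ 3 * n ^ 5
theorem3 = 12 , bound
  where
  bound : ∀ (n m : ℕ) → 1 ≤ n → (Γ : Mat n → GF2^ m) → IsLinearCodeOfMatrices n m Γ → (3 * n ^ 2 ∸ m) ^ 3 ≤ 12 ^ 3 * n ^ 5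
  bound n m 1≤n Γ code with log₈ n 1≤n
  ... | k , 8^k≤n , n<8^1+k = cube-bound n (2 ^ k) (3 * n ^ 2 ∸ m) 1≤n
    (≤-trans (<⇒≤ n<8^1+k) (≤-reflexive (cong (8 *_) (sym (cube-2^ k)))))
    (deficit-bound n m 1≤n Γ code k
      -- With K = 2^k ≥ 1, this is K² ≤ K³ = 8^k ≤ n.
      (≤-trans (m≤n*m (2 ^ k * 2 ^ k) (2 ^ k) {{m^n≢0 2 k}}) (≤-trans (≤-reflexive (cube-2^ k)) 8^k≤n)))
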